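{- For positive integers $k$ and $g$, the $k$-power domination number of the Sierpiński graph $\mathcal{S}_g$ is $$\gamma_{P,k}(\mathcal{S}_g)=\begin{cases}\dfrac{3^{g-2}+1}{2}, & g\ge 2,\ k=1,\\[2mm] 1, & g=1,\ k=1,\\[1mm] 1, & k\ge 2.\end{cases}$$
   Context: Sierpiński graph: $\mathcal{S}_1$ is a triangle whose three vertices are its outmost vertices. Given $\mathcal{S}_g$ with outmost vertices $A_g,B_g,C_g$, take three copies $\mathcal{S}_g^\theta$ ($\theta=1,2,3$) with outmost vertices $A_g^\theta,B_g^\theta,C_g^\theta$, identify $B_g^1$ with $A_g^2$, $C_g^2$ with $B_g^3$, and $C_g^1$ with $A_g^3$; the result is $\mathcal{S}_{g+1}$, with outmost vertices $A_g^1$, $B_g^2$, $C_g^3$. For a graph $G$, nonnegative integer $k$ and $D\subseteq V(G)$: $P^0_{G,k}(D)=N_G[D]$ (closed neighborhood), $P^{i+1}_{G,k}(D)=\bigcup\{N_G[v]: v\in P^i_{G,k}(D),\ |N_G[v]\setminus P^i_{G,k}(D)|\le k\}$; the increasing sequence stabilizes at $P^\infty_{G,k}(D)$. $D$ is a $k$-power dominating set if $P^\infty_{G,k}(D)=V(G)$; $\gamma_{P,k}(G)$ is the minimum size of such a set. -}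

module Defs where

open import Data.Nat using (ℕ; zero; suc; _+_; _*_; _∸_; _≤_; _≡ᵇ_; _≤ᵇ_)
open import Data.Bool using (Bool; true; false; _∧_; _∨_; not; if_then_else_)
open import Data.List using (List; []; _∷_; _++_; map; filterᵇ; length; deduplicateᵇ)
open import Data.Bool.ListAction using (any)
open import Data.List.Membership.Propositional using (_∈_)
open import Data.List.Relation.Unary.All using (All)
open import Data.Product using (_×_; _,_; Σ; ∃)
open import Relation.Binary.PropositionalEquality using (_≡_)

-- A finite simple graph with vertices labelled by natural numbers,
-- together with three distinguished (outmost) vertices A, B, C.
-- 'bound' is a strict upper bound on all vertex labels (used for relabelling copies).
record Graph : Set where
  field
    V     : List ℕ          -- vertex set (duplicate-free)
    E     : List (ℕ × ℕ)    -- edges (unordered; stored as pairs)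
    A B C : ℕ
    bound : ℕ
open Graph public

triangle : Graph
triangle = record { V = 0 ∷ 1 ∷ 2 ∷ [] ; E = (0 , 1) ∷ (1 , 2) ∷ (0 , 2) ∷ []
                  ; A = 0 ; B = 1 ; C = 2 ; bound = 3 }

-- One step of the construction: three copies of G, gluing
--   B¹ = A², C² = B³, C¹ = A³ ; new outmost vertices A¹, B², C³.
-- Copy 1 keeps labels; copy 2 uses relabelling r₂; copy 3 uses r₃.
module _ (G : Graph) where
  r₂ : ℕ → ℕ
  r₂ v = if v ≡ᵇ A G then B G else bound G + v

  r₃ : ℕ → ℕ
  r₃ v = if v ≡ᵇ A G then C G else
         (if v ≡ᵇ B G then r₂ (C G) else 2 * bound G + v)

  mapE : (ℕ → ℕ) → List (ℕ × ℕ) → List (ℕ × ℕ)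
  mapE f = map (λ { (a , b) → (f a , f b) })

  glue : Graph
  glue = record
    { V = deduplicateᵇ _≡ᵇ_ (V G ++ map r₂ (V G) ++ map r₃ (V G))
    ; E = E G ++ mapE r₂ (E G) ++ mapE r₃ (E G)
    ; A = A G ; B = r₂ (B G) ; C = r₃ (C G)
    ; bound = 3 * bound G }

-- Sfrom n = 𝒮_{n+1}
Sfrom : ℕ → Graph
Sfrom zero    = triangle
Sfrom (suc n) = glue (Sfrom n)

-- 𝒮 g for g ≥ 1 (𝒮 0 is not meaningful and coincides with 𝒮 1)
𝒮 : ℕ → Graph
𝒮 g = Sfrom (g ∸ 1)

adj : Graph → ℕ → ℕ → Bool
adj G u v = any (λ { (a , b) → ((a ≡ᵇ u) ∧ (b ≡ᵇ v)) ∨ ((a ≡ᵇ v) ∧ (b ≡ᵇ u)) }) (E G)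

inN : Graph → ℕ → ℕ → Bool
inN G v u = (u ≡ᵇ v) ∨ adj G v u

P : Graph → ℕ → List ℕ → ℕ → ℕ → Bool
P G k D zero    u = any (λ d → inN G d u) D
P G k D (suc i) u =
  any (λ v → P G k D i v
             ∧ (length (filterᵇ (λ w → inN G v w ∧ not (P G k D i w)) (V G)) ≤ᵇ k)
             ∧ inN G v u)
      (V G)

-- P^∞ = ⋃_i P^i (the limit of the increasing sequence); D is k-power
-- dominating iff D ⊆ V(G) and every vertex lies in P^∞.
IsKPowerDom : Graph → ℕ → List ℕ → Set
IsKPowerDom G k D = All (_∈ V G) D × (∀ u → u ∈ V G → ∃ λ i → P G k D i u ≡ true)

-- γ_{P,k}(G) = n : some k-power dominating set has size n, and every one has size ≥ n.
-- (Sets are given as lists; a list with repetitions is only longer, so the minimum is unaffected.)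
PowerDomNumber : Graph → ℕ → ℕ → Set
PowerDomNumber G k n =
  (Σ (List ℕ) λ D → IsKPowerDom G k D × length D ≡ n)
  × (∀ D → IsKPowerDom G k D → n ≤ length D)

{-# OPTIONS --safe #-}
module Submission where

-- For k ≥ 2 a fully observed triangle passes observation through each of its
-- corners to the adjacent triangle, so by connectedness one vertex suffices.
--
-- For k = 1, regard 𝒮_g as 3^(g-2) copies of 𝒮₂ glued at corners. In each copy
-- the three midpoints form a fort, so a power dominating set meets every copy;
-- a vertex lies in at most two copies, whence 3^(g-2) ≤ 2|D|. Conversely, pair
-- up all copies but the one at corner A along shared corners so that deleting
-- the pairing leaves a Hamiltonian path of copies. The shared corners together
-- with a midpoint of the unpaired copy are power dominating: this copy is
-- observed outright, and observation then runs along the path, since a copy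
-- with one corner in D is observed once it is entered at another corner.

open import Defs
open import Data.Bool using (Bool; true; false; T; _∧_; not; T?)
open import Data.Bool.Properties using (T-∧; T-∨; T-≡)
open import Data.Bool.ListAction using (any)
open import Data.Empty using (⊥-elim)
open import Data.List using (List; []; _∷_; _++_; map; filterᵇ; length; deduplicateᵇ; cartesianProductWith)
open import Data.List.Membership.Propositional using (_∈_; lose; find)
open import Data.List.Membership.Propositional.Properties using (∈-map⁺; ∈-map⁻; ∈-++⁺ˡ; ∈-++⁺ʳ; ∈-++⁻; ∈-∃++; ∈-filter⁺; ∈-filter⁻; ∈-deduplicate⁻)
open import Data.List.Properties using (length-++; length-map)
open import Data.List.Relation.Unary.All using (All; []; _∷_)
import Data.List.Relation.Unary.All as All
open import Data.List.Relation.Unary.All.Properties using (all-filter)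
open import Data.List.Relation.Unary.AllPairs using ([]; _∷_)
open import Data.List.Relation.Unary.Any using (here; there)
open import Data.List.Relation.Unary.Any.Properties using (any⁺; any⁻; deduplicate⁺)
open import Data.List.Relation.Unary.Unique.Propositional using (Unique)
import Data.List.Relation.Unary.Unique.Propositional.Properties as Unique
open import Data.Nat using (ℕ; zero; suc; _+_; _*_; _∸_; _^_; _≤_; _<_; z≤n; s≤s; _≡ᵇ_; _≤ᵇ_; _⊔_; _≤′_; ≤′-refl; ≤′-step)
open import Data.Nat.Properties
open import Data.Nat.DivMod using (_/_; m*n/n≡m)
open import Data.Nat.Tactic.RingSolver using (solve-∀)
open import Data.Product using (_×_; _,_; Σ; ∃; proj₁; proj₂)
open import Data.Sum using (_⊎_; inj₁; inj₂; map₁)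
open import Data.Vec using (Vec; []; _∷_; replicate; _∷ʳ_; init; initLast)
open import Data.Vec.Properties using (≡-dec; init-∷ʳ; ∷-injective)
open import Function using (_∘_; id)
open import Function.Bundles using (Equivalence)
open import Relation.Binary.Definitions using (DecidableEquality)
open import Relation.Binary.PropositionalEquality using (_≡_; _≢_; refl; sym; trans; cong; cong₂; subst; subst₂)
open import Relation.Nullary using (¬_; Dec; yes; no; contradiction)
open import Relation.Nullary.Decidable using (map′; from-yes; ¬?; _×-dec_; _⊎-dec_; _→-dec_)
open import Relation.Unary using (Decidable)

-- Boolean search and lists without repetition

any-∈⁻ : ∀ {X : Set} (p : X → Bool) xs → T (any p xs) → ∃ λ x → x ∈ xs × T (p x)
any-∈⁻ p xs t = find (any⁻ p xs t)

any-∈⁺ : ∀ {X : Set} (p : X → Bool) {x xs} → x ∈ xs → T (p x) → T (any p xs)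
any-∈⁺ p x∈xs px = any⁺ p (lose x∈xs px)

unique-⊆⇒length≤ : ∀ {X : Set} {xs ys : List X} → Unique xs →
  (∀ {x} → x ∈ xs → x ∈ ys) → length xs ≤ length ys
unique-⊆⇒length≤ [] _ = z≤n
unique-⊆⇒length≤ {xs = x ∷ xs} (x∉xs ∷ u) sub with ∈-∃++ (sub (here refl))
... | as , bs , refl = ≤-trans (s≤s (unique-⊆⇒length≤ u sub′)) (≤-reflexive eq)
  where
  sub′ : ∀ {y} → y ∈ xs → y ∈ as ++ bs
  sub′ y∈xs with ∈-++⁻ as (sub (there y∈xs))
  ... | inj₁ y∈as         = ∈-++⁺ˡ y∈as
  ... | inj₂ (here refl)  = contradiction refl (All.lookup x∉xs y∈xs)
  ... | inj₂ (there y∈bs) = ∈-++⁺ʳ as y∈bs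
  eq : suc (length (as ++ bs)) ≡ length (as ++ x ∷ bs)
  eq rewrite length-++ as {bs} | length-++ as {x ∷ bs} = sym (+-suc (length as) (length bs))

deduplicateᵇ-unique : ∀ xs → Unique (deduplicateᵇ _≡ᵇ_ xs)
deduplicateᵇ-unique []       = []
deduplicateᵇ-unique (x ∷ xs) =
  All.map (λ x≢y eq → x≢y (≡⇒≡ᵇ x _ eq)) (all-filter _ (deduplicateᵇ _≡ᵇ_ xs))
  ∷ Unique.filter⁺ _ (deduplicateᵇ-unique xs)

∈-deduplicateᵇ⁺ : ∀ {xs x} → x ∈ xs → x ∈ deduplicateᵇ _≡ᵇ_ xs
∈-deduplicateᵇ⁺ = deduplicate⁺ _ (λ {x} {y} y≡ᵇx z≡x → trans z≡x (sym (≡ᵇ⇒≡ y x y≡ᵇx)))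

-- Addresses of vertices

data Corner : Set where
  α β γ : Corner

_≟ᶜ_ : DecidableEquality Corner
α ≟ᶜ α = yes refl
α ≟ᶜ β = no λ ()
α ≟ᶜ γ = no λ ()
β ≟ᶜ α = no λ ()
β ≟ᶜ β = yes refl
β ≟ᶜ γ = no λ ()
γ ≟ᶜ α = no λ ()
γ ≟ᶜ β = no λ ()
γ ≟ᶜ γ = yes refl

Cell : ℕ → Set
Cell = Vec Corner

corner : Graph → Corner → ℕ
corner G α = A G
corner G β = B G
corner G γ = C G

relabel : Graph → Corner → ℕ → ℕ
relabel G α = id
relabel G β = r₂ G
relabel G γ = r₃ G

-- A word of length n names one of the 3ⁿ small triangles of 𝒮 (suc n): its
-- head selects the copy, its tail a triangle inside that copy.
lab : ∀ {n} → Cell n → Corner → ℕ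
lab []              x = corner triangle x
lab (_∷_ {n} θ w) x = relabel (Sfrom n) θ (lab w x)

-- Keeps the label arithmetic of `glue` faithful: distinct corners pass distinct tests in `r₂` and
-- `r₃`, and corners below `bound` can serve as remainders.
record Proper (G : Graph) : Set where
  field
    corner<bound : ∀ x → corner G x < bound G
    corner-inj   : ∀ x y → corner G x ≡ corner G y → x ≡ y

rank : Corner → ℕ
rank α = 0
rank β = 1
rank γ = 2

rank-inj : ∀ x y → rank x ≡ rank y → x ≡ y
rank-inj α α _ = refl
rank-inj β β _ = refl
rank-inj γ γ _ = refl

rank<3 : ∀ x → rank x < 3
rank<3 α = s≤s z≤n
rank<3 β = s≤s (s≤s z≤n)
rank<3 γ = s≤s (s≤s (s≤s z≤n))

-- Uniqueness of quotient and remainder on division by `b`.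
digit-unique : ∀ {b x y} i j → x < b → y < b → i * b + x ≡ j * b + y → i ≡ j × x ≡ y
digit-unique zero zero _ _ eq = refl , eq
digit-unique {b} {x} {y} zero (suc j) x<b _ eq = contradiction
  (≤-<-trans (≤-trans (m≤m+n b (j * b)) (m≤m+n (b + j * b) y)) (subst (_< b) eq x<b)) (<-irrefl refl)
digit-unique {b} {x} {y} (suc i) zero _ y<b eq = contradiction
  (≤-<-trans (≤-trans (m≤m+n b (i * b)) (m≤m+n (b + i * b) x)) (subst (_< b) (sym eq) y<b)) (<-irrefl refl)
digit-unique {b} {x} {y} (suc i) (suc j) x<b y<b eq
  with digit-unique {b} i j x<b y<b
         (+-cancelˡ-≡ b _ _ (trans (sym (+-assoc b (i * b) x)) (trans eq (+-assoc b (j * b) y))))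
... | refl , x≡y = refl , x≡y

≡ᵇ-refl : ∀ n → (n ≡ᵇ n) ≡ true
≡ᵇ-refl n = Equivalence.to T-≡ (≡⇒≡ᵇ n n refl)

module _ {G : Graph} (proper : Proper G) where
  open Proper proper

  -- Every label of glue G is i * bound G + x with x < bound G; a glued vertex
  -- carries the label of the earlier of its two copies.
  data Block (θ : Corner) (v : ℕ) : ℕ → Set where
    own   : Block θ v (rank θ * bound G + v)
    moved : ∀ φ → φ ≢ θ → v ≡ corner G φ → Block θ v (rank φ * bound G + corner G θ)

  block-r₂ : ∀ v → Block β v (r₂ G v)
  block-r₂ v with v ≡ᵇ A G in eq
  ... | true  = moved α (λ ()) (≡ᵇ⇒≡ v (A G) (Equivalence.from T-≡ eq))
  ... | false = subst (λ b → Block β v (b + v)) (+-identityʳ (bound G)) own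

  r₂-C : r₂ G (C G) ≡ 1 * bound G + C G
  r₂-C with C G ≡ᵇ A G in eq
  ... | true  with () ← corner-inj γ α (≡ᵇ⇒≡ (C G) (A G) (Equivalence.from T-≡ eq))
  ... | false = cong (_+ C G) (sym (+-identityʳ (bound G)))

  block : ∀ θ v → Block θ v (relabel G θ v)
  block α v = own
  block β v = block-r₂ v
  block γ v with v ≡ᵇ A G in eqA
  ... | true  = moved α (λ ()) (≡ᵇ⇒≡ v (A G) (Equivalence.from T-≡ eqA))
  ... | false with v ≡ᵇ B G in eqB
  ...   | true  = subst (Block γ v) (sym r₂-C) (moved β (λ ()) (≡ᵇ⇒≡ v (B G) (Equivalence.from T-≡ eqB)))
  ...   | false = own

  digit< : ∀ φ {x} → x < bound G → rank φ * bound G + x < 3 * bound G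
  digit< φ {x} x<b = ≤-trans (+-monoʳ-< (rank φ * bound G) x<b)
    (≤-trans (≤-reflexive (+-comm (rank φ * bound G) (bound G))) (*-monoˡ-≤ (bound G) (rank<3 φ)))

  relabel< : ∀ θ {v} → v < bound G → relabel G θ v < bound (glue G)
  relabel< θ {v} v<b with relabel G θ v | block θ v
  ... | _ | own         = digit< θ v<b
  ... | _ | moved φ _ _ = digit< φ (corner<bound θ)

  -- Both labels are split into quotient and remainder by `bound G`, and `digit-unique` compares
  -- them. Two unmoved labels come from one copy; one moved and one unmoved label form a glued pair.
  relabel-inv : ∀ θ φ {u v} → u < bound G → v < bound G → relabel G θ u ≡ relabel G φ v →
    (θ ≡ φ × u ≡ v) ⊎ (θ ≢ φ × u ≡ corner G φ × v ≡ corner G θ)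
  relabel-inv θ φ {u} {v} u<b v<b eq
    with relabel G θ u | block θ u | relabel G φ v | block φ v
  ... | _ | own | _ | own
        with θ≡φ , u≡v ← digit-unique (rank θ) (rank φ) u<b v<b eq
        = inj₁ (rank-inj θ φ θ≡φ , u≡v)
  ... | _ | own | _ | moved ψ ψ≢φ v≡ψ
        with i , u≡φ ← digit-unique (rank θ) (rank ψ) u<b (corner<bound φ) eq
        with refl ← rank-inj θ ψ i
        = inj₂ (ψ≢φ , u≡φ , v≡ψ)
  ... | _ | moved ψ ψ≢θ u≡ψ | _ | own
        with i , v≡θ ← digit-unique (rank ψ) (rank φ) (corner<bound θ) v<b eq
        with refl ← rank-inj ψ φ i
        = inj₂ ((λ θ≡ψ → ψ≢θ (sym θ≡ψ)) , u≡ψ , sym v≡θ)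
  -- The remainders show that the copies agree, the quotients that `u` and `v` are the same corner.
  ... | _ | moved ψ _ u≡ψ | _ | moved χ _ v≡χ
        with i , θ≡φ ← digit-unique (rank ψ) (rank χ) (corner<bound θ) (corner<bound φ) eq
        with refl ← rank-inj ψ χ i
        = inj₁ (corner-inj θ φ θ≡φ , trans u≡ψ (sym v≡χ))

  -- The identifications B¹ = A², C² = B³, C¹ = A³ in one symmetric rule.
  relabel-join : ∀ θ φ → relabel G θ (corner G φ) ≡ relabel G φ (corner G θ)
  relabel-join α α = refl
  relabel-join β β = refl
  relabel-join γ γ = refl
  relabel-join α β rewrite ≡ᵇ-refl (A G) = refl
  relabel-join β α rewrite ≡ᵇ-refl (A G) = refl
  relabel-join α γ rewrite ≡ᵇ-refl (A G) = refl
  relabel-join γ α rewrite ≡ᵇ-refl (A G) = refl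
  relabel-join β γ = sym (relabel-join γ β)
  relabel-join γ β with B G ≡ᵇ A G in eq
  ... | true  with () ← corner-inj β α (≡ᵇ⇒≡ (B G) (A G) (Equivalence.from T-≡ eq))
  ... | false rewrite ≡ᵇ-refl (B G) = refl

  corner-glue : ∀ x → corner (glue G) x ≡ relabel G x (corner G x)
  corner-glue α = refl
  corner-glue β = refl
  corner-glue γ = refl

  glue-proper : Proper (glue G)
  glue-proper = record { corner<bound = λ x → subst (_< bound (glue G)) (sym (corner-glue x)) (relabel< x (corner<bound x))
                       ; corner-inj = inj }
    where
    inj : ∀ x y → corner (glue G) x ≡ corner (glue G) y → x ≡ y
    inj x y eq with relabel-inv x y (corner<bound x) (corner<bound y)
                      (trans (sym (corner-glue x)) (trans eq (corner-glue y)))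
    ... | inj₁ (x≡y , _)      = x≡y
    ... | inj₂ (_ , x≡y , _) = corner-inj x y x≡y

Sfrom-proper : ∀ n → Proper (Sfrom n)
Sfrom-proper zero    = record { corner<bound = λ { α → s≤s z≤n ; β → s≤s (s≤s z≤n) ; γ → s≤s (s≤s (s≤s z≤n)) }
                              ; corner-inj = inj }
  where
  inj : ∀ x y → corner triangle x ≡ corner triangle y → x ≡ y
  inj α α _ = refl
  inj β β _ = refl
  inj γ γ _ = refl
Sfrom-proper (suc n) = glue-proper (Sfrom-proper n)

lab<bound : ∀ {n} (w : Cell n) x → lab w x < bound (Sfrom n)
lab<bound []            x = Proper.corner<bound (Sfrom-proper 0) x
lab<bound (_∷_ {n} θ w) x = relabel< (Sfrom-proper n) θ (lab<bound w x)

lab-replicate : ∀ n x → lab (replicate n x) x ≡ corner (Sfrom n) x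
lab-replicate zero    x = refl
lab-replicate (suc n) x =
  trans (cong (relabel (Sfrom n) x) (lab-replicate n x)) (sym (corner-glue (Sfrom-proper n) x))

lab-∷-inv : ∀ {n} θ φ (w w′ : Cell n) x y → lab (θ ∷ w) x ≡ lab (φ ∷ w′) y →
  (θ ≡ φ × lab w x ≡ lab w′ y) ⊎ (θ ≢ φ × lab w x ≡ corner (Sfrom n) φ × lab w′ y ≡ corner (Sfrom n) θ)
lab-∷-inv {n} θ φ w w′ x y = relabel-inv (Sfrom-proper n) θ φ (lab<bound w x) (lab<bound w′ y)

lab-injʳ : ∀ {n} (w : Cell n) x y → lab w x ≡ lab w y → x ≡ y
lab-injʳ [] x y eq = Proper.corner-inj (Sfrom-proper 0) x y eq
lab-injʳ (θ ∷ w) x y eq with lab-∷-inv θ θ w w x y eq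
... | inj₁ (_ , eq′)     = lab-injʳ w x y eq′
... | inj₂ (θ≢θ , _ , _) = contradiction refl θ≢θ

-- An outmost vertex is never glued: copy `φ` meets copy `θ` at its corner `θ`, which differs from
-- its corner `φ`.
corner-address : ∀ {n} (w : Cell n) x φ → lab w x ≡ corner (Sfrom n) φ → w ≡ replicate n φ × x ≡ φ
corner-address [] x φ eq = refl , Proper.corner-inj (Sfrom-proper 0) x φ eq
corner-address (_∷_ {n} θ w) x φ eq
  with lab-∷-inv θ φ w (replicate n φ) x φ (trans eq (sym (lab-replicate (suc n) φ)))
... | inj₁ (refl , eq′)
      with refl , refl ← corner-address w x φ (trans eq′ (lab-replicate n φ)) = refl , refl
... | inj₂ (θ≢φ , _ , eq′) =
      contradiction (Proper.corner-inj (Sfrom-proper n) θ φ (trans (sym eq′) (lab-replicate n φ))) θ≢φ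

_≟ʷ_ : ∀ {n} → DecidableEquality (Cell n)
_≟ʷ_ = ≡-dec _≟ᶜ_

-- The only other address of the same vertex, or the address itself if there is none.
twin : ∀ {n} → Cell n → Corner → Cell n × Corner
twin []            x = [] , x
twin (_∷_ {n} θ w) x with w ≟ʷ replicate n x
... | yes _ = x ∷ replicate n θ , θ
... | no  _ = θ ∷ proj₁ (twin w x) , proj₂ (twin w x)

-- The words are compared up to the first letter where they differ. There the vertex is a corner of
-- both copies, and `corner-address` determines the remaining letters.
twin-complete : ∀ {n} (w w′ : Cell n) x y → lab w x ≡ lab w′ y →
  (w′ , y) ≡ (w , x) ⊎ (w′ , y) ≡ twin w x
twin-complete [] [] x y eq with refl ← Proper.corner-inj (Sfrom-proper 0) x y eq = inj₁ refl
twin-complete (_∷_ {n} θ w) (φ ∷ w′) x y eq with lab-∷-inv θ φ w w′ x y eq | w ≟ʷ replicate n x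
... | inj₁ (refl , eq′) | yes refl
      with refl , refl ← corner-address w′ y x (trans (sym eq′) (lab-replicate n x)) = inj₁ refl
... | inj₁ (refl , eq′) | no _ with twin-complete w w′ x y eq′
...   | inj₁ refl = inj₁ refl
...   | inj₂ refl = inj₂ refl
twin-complete (_∷_ {n} θ w) (φ ∷ w′) x y eq | inj₂ (_ , eq₁ , eq₂) | d
  with refl , refl ← corner-address w x φ eq₁ | refl , refl ← corner-address w′ y θ eq₂ | d
... | yes _ = inj₂ refl
... | no ¬p = contradiction refl ¬p

-- Here `p` names a copy of 𝒮₂ and the last letter a small triangle in it; triangles `θ` and `x`
-- meet in a midpoint. As the word does not end in `x`, `twin` exchanges letters only at its very
-- end.
twin-midpoint : ∀ {m} (p : Cell m) {θ x} → θ ≢ x → twin (p ∷ʳ θ) x ≡ (p ∷ʳ x , θ)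
twin-midpoint [] _ = refl
twin-midpoint (_∷_ {m} φ p) {θ} {x} θ≢x with (p ∷ʳ θ) ≟ʷ replicate (suc m) x
... | yes eq = contradiction (last-replicate p eq) θ≢x
  where
  last-replicate : ∀ {m} (p : Cell m) → p ∷ʳ θ ≡ replicate (suc m) x → θ ≡ x
  last-replicate []      refl = refl
  last-replicate (_ ∷ p) eq′  = last-replicate p (proj₂ (∷-injective eq′))
... | no _ rewrite twin-midpoint p θ≢x = refl

-- The gluing relation on words alone, so that inductions over copies avoid label arithmetic. It
-- serves both for small triangles and for copies of 𝒮₂.
data Join : ∀ {n} → Cell n → Corner → Cell n → Corner → Set where
  same  : ∀ {n} {w : Cell n} {x} → Join w x w x
  here  : ∀ {n θ φ} → Join (θ ∷ replicate n φ) φ (φ ∷ replicate n θ) θ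
  there : ∀ {n θ} {w w′ : Cell n} {x y} → Join w x w′ y → Join (θ ∷ w) x (θ ∷ w′) y

join-lab : ∀ {n} {w w′ : Cell n} {x y} → Join w x w′ y → lab w x ≡ lab w′ y
join-lab same = refl
join-lab (here {n} {θ} {φ}) = trans (cong (relabel (Sfrom n) θ) (lab-replicate n φ))
  (trans (relabel-join (Sfrom-proper n) θ φ) (cong (relabel (Sfrom n) φ) (sym (lab-replicate n θ))))
join-lab (there {n} {θ} j) = cong (relabel (Sfrom n) θ) (join-lab j)

replicate-∷ʳ : ∀ {X : Set} n (x : X) → replicate n x ∷ʳ x ≡ replicate (suc n) x
replicate-∷ʳ zero    x = refl
replicate-∷ʳ (suc n) x = cong (x ∷_) (replicate-∷ʳ n x)

-- Where two copies of 𝒮₂ share a corner, so do the small triangles sitting at that corner.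
join-∷ʳ : ∀ {n} {w w′ : Cell n} {x y} → Join w x w′ y → Join (w ∷ʳ x) x (w′ ∷ʳ y) y
join-∷ʳ same = same
join-∷ʳ (here {n} {θ} {φ}) rewrite replicate-∷ʳ n θ | replicate-∷ʳ n φ = here
join-∷ʳ (there j) = there (join-∷ʳ j)

join-midpoint : ∀ {m} (p : Cell m) x y → Join (p ∷ʳ x) y (p ∷ʳ y) x
join-midpoint []      x y = here
join-midpoint (θ ∷ p) x y = there (join-midpoint p x y)

-- Vertices and edges

V-unique : ∀ n → Unique (V (Sfrom n))
V-unique zero    = ((λ ()) ∷ (λ ()) ∷ []) ∷ ((λ ()) ∷ []) ∷ [] ∷ []
V-unique (suc n) = deduplicateᵇ-unique _

lab∈V : ∀ {n} (w : Cell n) x → lab w x ∈ V (Sfrom n)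
lab∈V [] α = here refl
lab∈V [] β = there (here refl)
lab∈V [] γ = there (there (here refl))
lab∈V (_∷_ {n} θ w) x = ∈-deduplicateᵇ⁺ (go θ)
  where
  vs = V (Sfrom n)
  go : ∀ θ → relabel (Sfrom n) θ (lab w x) ∈ vs ++ map (r₂ (Sfrom n)) vs ++ map (r₃ (Sfrom n)) vs
  go α = ∈-++⁺ˡ (lab∈V w x)
  go β = ∈-++⁺ʳ vs (∈-++⁺ˡ (∈-map⁺ (r₂ (Sfrom n)) (lab∈V w x)))
  go γ = ∈-++⁺ʳ vs (∈-++⁺ʳ (map (r₂ (Sfrom n)) vs) (∈-map⁺ (r₃ (Sfrom n)) (lab∈V w x)))

V-address : ∀ n {v} → v ∈ V (Sfrom n) → ∃ λ (w : Cell n) → ∃ λ x → v ≡ lab w x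
V-address zero (here refl)                 = [] , α , refl
V-address zero (there (here refl))         = [] , β , refl
V-address zero (there (there (here refl))) = [] , γ , refl
V-address (suc n) v∈ with ∈-++⁻ (V (Sfrom n)) (∈-deduplicate⁻ _ _ v∈)
... | inj₁ v∈₁ with w , x , refl ← V-address n v∈₁ = α ∷ w , x , refl
... | inj₂ v∈₂₃ with ∈-++⁻ (map (r₂ (Sfrom n)) (V (Sfrom n))) v∈₂₃
...   | inj₁ v∈₂ with u , u∈ , refl ← ∈-map⁻ _ v∈₂ with w , x , refl ← V-address n u∈ = β ∷ w , x , refl
...   | inj₂ v∈₃ with u , u∈ , refl ← ∈-map⁻ _ v∈₃ with w , x , refl ← V-address n u∈ = γ ∷ w , x , refl

-- The orientation in which `E triangle` stores its three edges.
data _≺_ : Corner → Corner → Set where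
  α≺β : α ≺ β
  β≺γ : β ≺ γ
  α≺γ : α ≺ γ

edge∈E : ∀ {n} (w : Cell n) {x y} → x ≺ y → (lab w x , lab w y) ∈ E (Sfrom n)
edge∈E [] α≺β = here refl
edge∈E [] β≺γ = there (here refl)
edge∈E [] α≺γ = there (there (here refl))
edge∈E (α ∷ w) x≺y = ∈-++⁺ˡ (edge∈E w x≺y)
edge∈E (_∷_ {n} β w) x≺y = ∈-++⁺ʳ (E (Sfrom n)) (∈-++⁺ˡ (∈-map⁺ _ (edge∈E w x≺y)))
edge∈E (_∷_ {n} γ w) x≺y =
  ∈-++⁺ʳ (E (Sfrom n)) (∈-++⁺ʳ (mapE (Sfrom n) (r₂ (Sfrom n)) (E (Sfrom n))) (∈-map⁺ _ (edge∈E w x≺y)))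

E-address : ∀ n {e} → e ∈ E (Sfrom n) → ∃ λ (w : Cell n) → ∃ λ x → ∃ λ y → e ≡ (lab w x , lab w y)
E-address zero (here refl)                 = [] , α , β , refl
E-address zero (there (here refl))         = [] , β , γ , refl
E-address zero (there (there (here refl))) = [] , α , γ , refl
E-address (suc n) e∈ with ∈-++⁻ (E (Sfrom n)) e∈
... | inj₁ e∈₁ with w , x , y , refl ← E-address n e∈₁ = α ∷ w , x , y , refl
... | inj₂ e∈₂₃ with ∈-++⁻ (mapE (Sfrom n) (r₂ (Sfrom n)) (E (Sfrom n))) e∈₂₃
...   | inj₁ e∈₂ with _ , f∈ , refl ← ∈-map⁻ _ e∈₂ with w , x , y , refl ← E-address n f∈ = β ∷ w , x , y , refl
...   | inj₂ e∈₃ with _ , f∈ , refl ← ∈-map⁻ _ e∈₃ with w , x , y , refl ← E-address n f∈ = γ ∷ w , x , y , refl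

inN-cell : ∀ {n} (w : Cell n) x y → T (inN (Sfrom n) (lab w x) (lab w y))
inN-cell {n} w x y = go x y
  where
  up : ∀ {x y} → x ≺ y → T (inN (Sfrom n) (lab w x) (lab w y))
  up {x} {y} x≺y = Equivalence.from T-∨ (inj₂ (any-∈⁺ _ (edge∈E w x≺y) (Equivalence.from T-∨
    (inj₁ (Equivalence.from T-∧ (≡⇒≡ᵇ (lab w x) (lab w x) refl , ≡⇒≡ᵇ (lab w y) (lab w y) refl))))))
  down : ∀ {x y} → y ≺ x → T (inN (Sfrom n) (lab w x) (lab w y))
  down {x} {y} y≺x = Equivalence.from T-∨ (inj₂ (any-∈⁺ _ (edge∈E w y≺x) (Equivalence.from T-∨
    (inj₂ (Equivalence.from T-∧ (≡⇒≡ᵇ (lab w y) (lab w y) refl , ≡⇒≡ᵇ (lab w x) (lab w x) refl))))))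
  self : ∀ x → T (inN (Sfrom n) (lab w x) (lab w x))
  self x = Equivalence.from T-∨ (inj₁ (≡⇒≡ᵇ (lab w x) (lab w x) refl))
  go : ∀ x y → T (inN (Sfrom n) (lab w x) (lab w y))
  go α α = self α
  go α β = up α≺β
  go α γ = up α≺γ
  go β α = down α≺β
  go β β = self β
  go β γ = up β≺γ
  go γ α = down α≺γ
  go γ β = down β≺γ
  go γ γ = self γ

-- Each edge lies in a small triangle, so a closed neighbourhood is made up of the small triangles
-- at its vertex.
inN-address : ∀ n {v u} → v ∈ V (Sfrom n) → T (inN (Sfrom n) v u) →
  ∃ λ (w : Cell n) → ∃ λ x → ∃ λ y → v ≡ lab w x × u ≡ lab w y
inN-address n {v} {u} v∈ t with Equivalence.to (T-∨ {u ≡ᵇ v}) t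
... | inj₁ u≡v with refl ← ≡ᵇ⇒≡ u v u≡v with w , x , eq ← V-address n v∈ = w , x , x , eq , eq
... | inj₂ adjacent with (a , b) , e∈ , te ← any-∈⁻ _ (E (Sfrom n)) adjacent
    with w , x , y , refl ← E-address n e∈ with Equivalence.to (T-∨ {(lab w x ≡ᵇ v) ∧ (lab w y ≡ᵇ u)}) te
... | inj₁ t₁ with p , q ← Equivalence.to (T-∧ {lab w x ≡ᵇ v}) t₁ = w , x , y , sym (≡ᵇ⇒≡ _ v p) , sym (≡ᵇ⇒≡ _ u q)
... | inj₂ t₂ with p , q ← Equivalence.to (T-∧ {lab w x ≡ᵇ u}) t₂ = w , y , x , sym (≡ᵇ⇒≡ _ v q) , sym (≡ᵇ⇒≡ _ u p)

-- Propagation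

T-not⁺ : ∀ {b} → ¬ T b → T (not b)
T-not⁺ {false} _ = _
T-not⁺ {true}  ¬t = ¬t _

T-not⁻ : ∀ {b} → T (not b) → ¬ T b
T-not⁻ {false} _ ()

undominated : Graph → ℕ → List ℕ → ℕ → ℕ → List ℕ
undominated G k D i v = filterᵇ (λ w → inN G v w ∧ not (P G k D i w)) (V G)

∈-undominated⁻ : ∀ G k D i v {w} → w ∈ undominated G k D i v →
  w ∈ V G × T (inN G v w) × ¬ T (P G k D i w)
∈-undominated⁻ G k D i v {w} w∈
  with w∈V , t ← ∈-filter⁻ (λ w → T? (inN G v w ∧ not (P G k D i w))) {xs = V G} w∈
  with n , ¬p ← Equivalence.to (T-∧ {inN G v w}) t = w∈V , n , T-not⁻ ¬p

∈-undominated⁺ : ∀ G k D i v {w} → w ∈ V G → T (inN G v w) → ¬ T (P G k D i w) →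
  w ∈ undominated G k D i v
∈-undominated⁺ G k D i v {w} w∈V n ¬p =
  ∈-filter⁺ (λ w → T? (inN G v w ∧ not (P G k D i w))) w∈V (Equivalence.from T-∧ (n , T-not⁺ ¬p))

P-suc⁻ : ∀ G k D i {u} → T (P G k D (suc i) u) →
  ∃ λ v → v ∈ V G × T (P G k D i v) × length (undominated G k D i v) ≤ k × T (inN G v u)
P-suc⁻ G k D i {u} t with v , v∈V , tv ← any-∈⁻ _ (V G) t
  with p , q ← Equivalence.to (T-∧ {P G k D i v}) tv
  with l , n ← Equivalence.to (T-∧ {length (undominated G k D i v) ≤ᵇ k}) q
  = v , v∈V , p , ≤ᵇ⇒≤ _ k l , n

P-suc⁺ : ∀ G k D i {u v} → v ∈ V G → T (P G k D i v) →
  length (undominated G k D i v) ≤ k → T (inN G v u) → T (P G k D (suc i) u)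
P-suc⁺ G k D i {u} v∈V p l n =
  any-∈⁺ _ v∈V (Equivalence.from T-∧ (p , Equivalence.from T-∧ (≤⇒≤ᵇ l , n)))

inN-refl : ∀ G v → T (inN G v v)
inN-refl G v = Equivalence.from T-∨ (inj₁ (≡⇒≡ᵇ v v refl))

module Propagation (G : Graph) (V-unique : Unique (V G)) (k : ℕ) (D : List ℕ) (D⊆V : All (_∈ V G) D) where

  undominated-length : ∀ i v (L : List ℕ) → (∀ {w} → w ∈ undominated G k D i v → w ∈ L) →
    length (undominated G k D i v) ≤ length L
  undominated-length i v L = unique-⊆⇒length≤ (Unique.filter⁺ _ V-unique)

  -- With nothing unobserved around it, `v` may propagate for every `k`.
  P-step : ∀ i {v} → v ∈ V G → (∀ {w} → T (inN G v w) → T (P G k D i w)) →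
    ∀ {u} → T (inN G v u) → T (P G k D (suc i) u)
  P-step i {v} v∈V dominated = P-suc⁺ G k D i v∈V (dominated (inN-refl G v))
    (≤-trans (undominated-length i v [] none) z≤n)
    where
    none : ∀ {w} → w ∈ undominated G k D i v → w ∈ []
    none w∈ with _ , n , ¬p ← ∈-undominated⁻ G k D i v w∈ = contradiction (dominated n) ¬p

  -- A vertex enters P^i together with the whole closed neighbourhood of a
  -- vertex that has just propagated, and that neighbourhood stays.
  P-mono : ∀ i {u} → T (P G k D i u) → T (P G k D (suc i) u)
  P-mono zero t with d , d∈D , n ← any-∈⁻ _ D t =
    P-step 0 (All.lookup D⊆V d∈D) (any-∈⁺ _ d∈D) n
  P-mono (suc i) t with v , v∈V , p , l , n ← P-suc⁻ G k D i t =
    P-step (suc i) v∈V (P-suc⁺ G k D i v∈V p l) n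

  P-mono-≤′ : ∀ {i j u} → i ≤′ j → T (P G k D i u) → T (P G k D j u)
  P-mono-≤′ ≤′-refl             t = t
  P-mono-≤′ (≤′-step {j} i≤′j) t = P-mono j (P-mono-≤′ i≤′j t)

  P-mono-≤ : ∀ {i j u} → i ≤ j → T (P G k D i u) → T (P G k D j u)
  P-mono-≤ i≤j = P-mono-≤′ (≤⇒≤′ i≤j)

  Obs : ℕ → Set
  Obs u = ∃ λ i → T (P G k D i u)

  obs-initial : ∀ {d u} → d ∈ D → T (inN G d u) → Obs u
  obs-initial d∈D n = 0 , any-∈⁺ _ d∈D n

  -- Finitely many observations share a stage: take the maximum and use monotonicity. The
  -- alternative `Q` is carried along because `Obs` is not decided.
  uniform : ∀ {Q : ℕ → Set} xs → (∀ {w} → w ∈ xs → Obs w ⊎ Q w) →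
    ∃ λ i → ∀ {w} → w ∈ xs → T (P G k D i w) ⊎ Q w
  uniform [] f = 0 , λ ()
  uniform {Q} (x ∷ xs) f with f (here refl) | uniform {Q} xs (f ∘ there)
  ... | inj₂ q | i , g = i , λ { (here refl) → inj₂ q ; (there w∈) → g w∈ }
  ... | inj₁ (j , p) | i , g = i ⊔ j , λ { (here refl) → inj₁ (P-mono-≤ (m≤n⊔m i j) p)
                                        ; (there w∈) → map₁ (P-mono-≤ (m≤m⊔n i j)) (g w∈) }

  -- The propagation rule freed of stages; `L` bounds the neighbours that may still be unobserved at
  -- the common stage.
  obs-force : ∀ {v} (L : List ℕ) → v ∈ V G → Obs v → length L ≤ k →
    (∀ {w} → T (inN G v w) → Obs w ⊎ w ∈ L) → ∀ {u} → T (inN G v u) → Obs u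
  obs-force {v} L v∈V (j , pv) L≤k nbrs n =
    suc (i ⊔ j) , P-suc⁺ G k D (i ⊔ j) v∈V (P-mono-≤ (m≤n⊔m i j) pv)
      (≤-trans (undominated-length (i ⊔ j) v L rest) L≤k) n
    where
    split : ∀ w → Obs w ⊎ (T (inN G v w) → w ∈ L)
    split w with T? (inN G v w)
    ... | no ¬n = inj₂ λ n → contradiction n ¬n
    ... | yes n with nbrs n
    ...   | inj₁ o = inj₁ o
    ...   | inj₂ l = inj₂ λ _ → l
    stage = uniform (V G) (λ {w} _ → split w)
    i = proj₁ stage
    rest : ∀ {w} → w ∈ undominated G k D (i ⊔ j) v → w ∈ L
    rest w∈ with w∈V , nw , ¬p ← ∈-undominated⁻ G k D (i ⊔ j) v w∈ with proj₂ stage w∈V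
    ... | inj₁ p = contradiction (P-mono-≤ (m≤m⊔n i j) p) ¬p
    ... | inj₂ l = l nw

-- For `x ≢ y` this is the remaining corner. The diagonal values make `third x` the reflection that
-- fixes `x` and swaps the other two corners.
third : Corner → Corner → Corner
third α α = α
third α β = γ
third α γ = β
third β α = γ
third β β = β
third β γ = α
third γ α = β
third γ β = α
third γ γ = γ

allᶜ? : {Q : Corner → Set} → Decidable Q → Dec (∀ x → Q x)
allᶜ? Q? = map′ (λ { (p , q , r) α → p ; (p , q , r) β → q ; (p , q , r) γ → r })
                (λ f → f α , f β , f γ) (Q? α ×-dec Q? β ×-dec Q? γ)

third-cover : ∀ x y → x ≢ y → ∀ z → z ≡ x ⊎ z ≡ y ⊎ z ≡ third x y
third-cover = from-yes (allᶜ? λ x → allᶜ? λ y → ¬? (x ≟ᶜ y) →-dec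
  allᶜ? λ z → (z ≟ᶜ x) ⊎-dec (z ≟ᶜ y) ⊎-dec (z ≟ᶜ third x y))

third-≢ˡ : ∀ x y → x ≢ y → third x y ≢ x
third-≢ˡ = from-yes (allᶜ? λ x → allᶜ? λ y → ¬? (x ≟ᶜ y) →-dec ¬? (third x y ≟ᶜ x))

third-≢ʳ : ∀ x y → x ≢ y → third x y ≢ y
third-≢ʳ = from-yes (allᶜ? λ x → allᶜ? λ y → ¬? (x ≟ᶜ y) →-dec ¬? (third x y ≟ᶜ y))

third-diag : ∀ x → third x x ≡ x
third-diag = from-yes (allᶜ? λ x → third x x ≟ᶜ x)

third-involutive : ∀ x y → third x (third x y) ≡ y
third-involutive = from-yes (allᶜ? λ x → allᶜ? λ y → third x (third x y) ≟ᶜ y)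

next : Corner → Corner
next α = β
next β = γ
next γ = α

next-≢ : ∀ x → x ≢ next x
next-≢ = from-yes (allᶜ? λ x → ¬? (x ≟ᶜ next x))

-- Propagation between small triangles

module CellPropagation (n k : ℕ) (D : List ℕ) (D⊆V : All (_∈ V (Sfrom n)) D) where
  open Propagation (Sfrom n) (V-unique n) k D D⊆V public

  ObsCell : Cell n → Set
  ObsCell w = ∀ x → Obs (lab w x)

  obsCell-initial : ∀ (w : Cell n) x → lab w x ∈ D → ObsCell w
  obsCell-initial w x d∈D y = obs-initial d∈D (inN-cell w x y)

  -- Only `w` and `w′` contain the shared vertex, so once `w` is observed all its unobserved
  -- neighbours lie in `w′`, hence in `L`, and it can force.
  spread : ∀ {w w′ : Cell n} {x y} (L : List ℕ) → lab w x ≡ lab w′ y → ObsCell w → length L ≤ k →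
    (∀ z → Obs (lab w′ z) ⊎ lab w′ z ∈ L) → ObsCell w′
  spread {w} {w′} {x} {y} L eq full L≤k part z with twin-complete w w′ x y eq
  ... | inj₁ refl = full z
  ... | inj₂ tw   = obs-force L (lab∈V w x) (full x) L≤k nbrs
                      (subst (λ v → T (inN (Sfrom n) v (lab w′ z))) (sym eq) (inN-cell w′ y z))
    where
    nbrs : ∀ {u} → T (inN (Sfrom n) (lab w x) u) → Obs u ⊎ u ∈ L
    nbrs t with w″ , x″ , y″ , eq″ , refl ← inN-address n (lab∈V w x) t
      with twin-complete w w″ x x″ eq″
    ... | inj₁ refl = inj₁ (full y″)
    -- Any triangle at the vertex reached at an address other than that of `w` is the twin, and so
    -- is `w′`.
    ... | inj₂ tw″ with refl ← trans tw″ (sym tw) = part y″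

  obs-all : (∀ w → ObsCell w) → IsKPowerDom (Sfrom n) k D
  obs-all full = D⊆V , λ u u∈V → dominated u∈V
    where
    dominated : ∀ {u} → u ∈ V (Sfrom n) → ∃ λ i → P (Sfrom n) k D i u ≡ true
    dominated u∈V with w , x , refl ← V-address n u∈V with i , t ← full w x = i , Equivalence.to T-≡ t

-- The case k ≥ 2

-- Move inside copy `θ` to the triangle where it meets copy `φ`, cross over, and move inside `φ`.
-- For equal copies the crossing joins a triangle to itself, so no case distinction arises.
connected : ∀ {n} (Q : Cell n → Set) →
  (∀ {w w′ x y} → Join w x w′ y → Q w → Q w′) → ∀ {w} → Q w → ∀ w′ → Q w′
connected {zero}  Q closed {[]} q [] = q
connected {suc n} Q closed {θ ∷ w} q (φ ∷ w′) = copy φ (closed here (copy θ q (replicate n φ))) w′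
  where
  copy : ∀ ψ {w} → Q (ψ ∷ w) → ∀ w′ → Q (ψ ∷ w′)
  copy ψ = connected (λ w → Q (ψ ∷ w)) (closed ∘ there)

nonempty : ∀ n k D → IsKPowerDom (Sfrom n) k D → 1 ≤ length D
nonempty n k (d ∷ D) _ = s≤s z≤n
nonempty n k [] (_ , dom) with i , p ← dom _ (lab∈V (replicate n α) α) =
  ⊥-elim (never i (Equivalence.from T-≡ p))
  where
  never : ∀ i {u} → ¬ T (P (Sfrom n) k [] i u)
  never (suc i) t with v , _ , p , _ ← P-suc⁻ (Sfrom n) k [] i t = never i p

powerDom-one : ∀ n k → (n ≡ 0 ⊎ 2 ≤ k) → PowerDomNumber (Sfrom n) k 1
powerDom-one n k small = (lab a α ∷ [] , obs-all (full small) , refl) , nonempty n k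
  where
  a : Cell n
  a = replicate n α
  open CellPropagation n k (lab a α ∷ []) (lab∈V a α ∷ [])

  spread₂ : 2 ≤ k → ∀ {w w′ x y} → Join w x w′ y → ObsCell w → ObsCell w′
  spread₂ 2≤k {w} {w′} {x} {y} j full =
    spread {w} {w′} {x} {y} (lab w′ (next y) ∷ lab w′ (third y (next y)) ∷ []) (join-lab j) full 2≤k part
    where
    part : ∀ z → Obs (lab w′ z) ⊎ lab w′ z ∈ (lab w′ (next y) ∷ lab w′ (third y (next y)) ∷ [])
    part z with third-cover y (next y) (next-≢ y) z
    ... | inj₁ refl        = inj₁ (subst Obs (join-lab j) (full x))
    ... | inj₂ (inj₁ refl) = inj₂ (here refl)
    ... | inj₂ (inj₂ refl) = inj₂ (there (here refl))

  full : n ≡ 0 ⊎ 2 ≤ k → ∀ w → ObsCell w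
  full (inj₁ refl) [] = obsCell-initial [] α (here refl)
  full (inj₂ 2≤k)     = connected ObsCell (spread₂ 2≤k) {a} (obsCell-initial a α (here refl))

-- The upper bound for k = 1

-- Pairing up the 𝒮₂ subgraphs along shared corners leaves only the one at
-- corner x unpaired; site x p is the corner at which p meets its partner.
site : ∀ {m} → Corner → Cell m → Corner
site x []      = x
site x (θ ∷ p) = site (third x θ) p

site-replicate : ∀ m x → site x (replicate m x) ≡ x
site-replicate zero    x = refl
site-replicate (suc m) x rewrite third-diag x = site-replicate m x

-- An outmost corner `y` is shared with no other copy, so no pairing happens there. This licenses
-- entering a larger copy at such a corner.
site-replicate-≢ : ∀ m x y → x ≢ y → site x (replicate m y) ≢ y
site-replicate-≢ zero    x y x≢y = x≢y
site-replicate-≢ (suc m) x y x≢y = site-replicate-≢ m (third x y) y (third-≢ʳ x y x≢y)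

-- `Q` crosses every shared corner except the pairing corner of the copy being entered: these are
-- the links left after the pairing is deleted.
Closed : ∀ {m} → Corner → (Cell m → Set) → Set
Closed x Q = ∀ {p p′ y y′} → Join p y p′ y′ → site x p′ ≢ y′ → Q p → Q p′

closed-copy : ∀ {m x} {Q : Cell (suc m) → Set} → Closed x Q → ∀ θ → Closed (third x θ) (λ p → Q (θ ∷ p))
closed-copy closed θ j = closed (there j)

-- Observation entering at corner y runs through the copies y, x, third x y in this order.
traverse : ∀ {m} x y → x ≢ y → (Q : Cell m → Set) → Closed x Q → Q (replicate m y) → ∀ p → Q p
traverse {zero}  x y x≢y Q closed q [] = q
traverse {suc m} x y x≢y Q closed q (θ ∷ p) = copies θ p
  where
  z : Corner
  z = third x y

  closed-x : Closed x (λ p → Q (x ∷ p))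
  closed-x = subst (λ v → Closed v (λ p → Q (x ∷ p))) (third-diag x) (closed-copy {Q = Q} closed x)

  closed-z : Closed y (λ p → Q (z ∷ p))
  closed-z = subst (λ v → Closed v (λ p → Q (z ∷ p))) (third-involutive x y) (closed-copy {Q = Q} closed z)

  copy-y : ∀ p → Q (y ∷ p)
  copy-y = traverse z y (third-≢ʳ x y x≢y) (λ p → Q (y ∷ p)) (closed-copy {Q = Q} closed y) q

  copy-x : ∀ p → Q (x ∷ p)
  copy-x = traverse x y x≢y (λ p → Q (x ∷ p)) closed-x
    (closed here (subst (λ v → site v (replicate m y) ≢ y) (sym (third-diag x)) (site-replicate-≢ m x y x≢y))
      (copy-y (replicate m x)))

  copy-z : ∀ p → Q (z ∷ p)
  copy-z = traverse y x (x≢y ∘ sym) (λ p → Q (z ∷ p)) closed-z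
    (closed here (subst (λ v → site v (replicate m x) ≢ x) (sym (third-involutive x y))
        (site-replicate-≢ m y x (x≢y ∘ sym)))
      (copy-x (replicate m z)))

  copies : ∀ θ p → Q (θ ∷ p)
  copies θ with third-cover x y x≢y θ
  ... | inj₁ refl        = copy-x
  ... | inj₂ (inj₁ refl) = copy-y
  ... | inj₂ (inj₂ refl) = copy-z

-- Copy `x` contains the seed and is filled by recursion. Each other copy `θ` is then entered from
-- it at corner `x`, and `traverse` applies with `third x θ` as its unpaired corner.
traverse-seed : ∀ {m} x (Q : Cell m → Set) → Closed x Q → Q (replicate m x) → ∀ p → Q p
traverse-seed {zero}  x Q closed q [] = q
traverse-seed {suc m} x Q closed q (θ ∷ p) = copy θ p
  where
  copy-x : ∀ p → Q (x ∷ p)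
  copy-x = traverse-seed x (λ p → Q (x ∷ p))
    (subst (λ v → Closed v (λ p → Q (x ∷ p))) (third-diag x) (closed-copy {Q = Q} closed x)) q

  copy : ∀ θ p → Q (θ ∷ p)
  copy θ with θ ≟ᶜ x
  ... | yes refl = copy-x
  ... | no θ≢x = traverse (third x θ) x (third-≢ˡ x θ (θ≢x ∘ sym)) (λ p → Q (θ ∷ p))
    (closed-copy {Q = Q} closed θ)
    (closed here (site-replicate-≢ m (third x θ) x (third-≢ˡ x θ (θ≢x ∘ sym))) (copy-x (replicate m θ)))

prefix : ∀ {m} → Corner → Cell m × Corner → Cell (suc m) × Corner
prefix θ (p , x) = θ ∷ p , x

-- One address for each pair's shared corner. Copy `x` leaves over its 𝒮₂ at corner `x`, copy `y`
-- the one at `z`, copy `z` the one at `y`; the last two share a vertex and are paired by the first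
-- entry.
junctions : ∀ m → Corner → List (Cell m × Corner)
junctions zero    x = []
junctions (suc m) x = (y ∷ replicate m z , z)
  ∷ map (prefix x) (junctions m x) ++ map (prefix y) (junctions m z) ++ map (prefix z) (junctions m y)
  where
  y = next x
  z = third x y

-- All but one of the 3^m copies are paired: of the three left over by the recursion, the new entry
-- pairs two.
junctions-length : ∀ m x → suc (2 * length (junctions m x)) ≡ 3 ^ m
junctions-length zero    x = refl
junctions-length (suc m) x = trans (cong (λ t → suc (2 * suc t)) lengths)
  (trans (arith (length xs) (length ys) (length zs))
    (cong₂ _+_ (junctions-length m x) (cong₂ _+_ (junctions-length m z)
      (trans (junctions-length m y) (sym (+-identityʳ (3 ^ m)))))))
  where
  y = next x
  z = third x y
  xs = junctions m x
  ys = junctions m z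
  zs = junctions m y

  lengths : length (map (prefix x) xs ++ map (prefix y) ys ++ map (prefix z) zs)
          ≡ length xs + (length ys + length zs)
  lengths = trans (length-++ (map (prefix x) xs)) (cong₂ _+_ (length-map (prefix x) xs)
    (trans (length-++ (map (prefix y) ys))
      (cong₂ _+_ (length-map (prefix y) ys) (length-map (prefix z) zs))))

  arith : ∀ a b c → suc (2 * suc (a + (b + c))) ≡ suc (2 * a) + (suc (2 * b) + suc (2 * c))
  arith = solve-∀

-- Each pair is listed from one side only; the `Join` is `same` for the listed partner and `here`
-- for the other, under the common prefix.
junctions-cover : ∀ {m} x (p : Cell m) →
  p ≡ replicate m x ⊎ ∃ λ q → ∃ λ y → (q , y) ∈ junctions m x × Join q y p (site x p)
junctions-cover x [] = inj₁ refl
junctions-cover {suc m} x (θ ∷ p) with third-cover x (next x) (next-≢ x) θ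
... | inj₁ refl rewrite third-diag x with junctions-cover x p
...   | inj₁ refl = inj₁ refl
...   | inj₂ (q , y , q∈ , j) = inj₂ (x ∷ q , y , there (∈-++⁺ˡ (∈-map⁺ (prefix x) q∈)) , there j)
junctions-cover {suc m} x (θ ∷ p) | inj₂ (inj₁ refl) with junctions-cover (third x θ) p
... | inj₁ refl rewrite site-replicate m (third x θ) = inj₂ (_ , _ , here refl , same)
... | inj₂ (q , y , q∈ , j) = inj₂ (θ ∷ q , y ,
        there (∈-++⁺ʳ (map (prefix x) (junctions m x)) (∈-++⁺ˡ (∈-map⁺ (prefix θ) q∈))) , there j)
junctions-cover {suc m} x (θ ∷ p) | inj₂ (inj₂ refl)
  rewrite third-involutive x (next x) with junctions-cover (next x) p
... | inj₁ refl rewrite site-replicate m (next x) = inj₂ (_ , _ , here refl , here)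
... | inj₂ (q , y , q∈ , j) = inj₂ (θ ∷ q , y ,
        there (∈-++⁺ʳ (map (prefix x) (junctions m x))
          (∈-++⁺ʳ (map (prefix (next x)) (junctions m (third x (next x)))) (∈-map⁺ (prefix θ) q∈))) , there j)

cornerLab : ∀ {m} → Cell m × Corner → ℕ
cornerLab (p , x) = lab (p ∷ʳ x) x

module _ (m : ℕ) where
  private
    a : Cell m
    a = replicate m α

  -- The first vertex is the midpoint between triangles `α` and `β` of the unpaired 𝒮₂, so both are
  -- observed at once; the others are the corners shared by pairs.
  dominatingSet : List ℕ
  dominatingSet = lab (a ∷ʳ α) β ∷ map cornerLab (junctions m α)

  dominatingSet⊆V : All (_∈ V (Sfrom (suc m))) dominatingSet
  dominatingSet⊆V = lab∈V (a ∷ʳ α) β ∷ All.tabulate inV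
    where
    inV : ∀ {d} → d ∈ map cornerLab (junctions m α) → d ∈ V (Sfrom (suc m))
    inV d∈ with (p , x) , _ , refl ← ∈-map⁻ cornerLab d∈ = lab∈V (p ∷ʳ x) x

  open CellPropagation (suc m) 1 dominatingSet dominatingSet⊆V

  Full : Cell m → Set
  Full p = ∀ θ → ObsCell (p ∷ʳ θ)

  -- The last triangle has its two midpoints observed; either of them forces the remaining corner.
  full-third : ∀ p {x y} → x ≢ y → ObsCell (p ∷ʳ x) → ObsCell (p ∷ʳ y) → Full p
  full-third p {x} {y} x≢y full-x full-y θ with third-cover x y x≢y θ
  ... | inj₁ refl        = full-x
  ... | inj₂ (inj₁ refl) = full-y
  ... | inj₂ (inj₂ refl) =
    spread {p ∷ʳ x} {p ∷ʳ z} {z} {x} (lab (p ∷ʳ z) z ∷ []) (join-lab (join-midpoint p x z)) full-x (s≤s z≤n) part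
    where
    z = third x y
    part : ∀ t → Obs (lab (p ∷ʳ z) t) ⊎ lab (p ∷ʳ z) t ∈ (lab (p ∷ʳ z) z ∷ [])
    part t with third-cover x y x≢y t
    ... | inj₁ refl        = inj₁ (subst Obs (join-lab (join-midpoint p x z)) (full-x z))
    ... | inj₂ (inj₁ refl) = inj₁ (subst Obs (join-lab (join-midpoint p y z)) (full-y z))
    ... | inj₂ (inj₂ refl) = inj₂ (here refl)

  -- Triangle `y′` of `p′` has its corner observed from `p` and one midpoint from triangle `x`. The
  -- shared corner forces the other midpoint, and `full-third` finishes.
  full-enter : ∀ p p′ {y x y′} → x ≢ y′ → Join p y p′ y′ → ObsCell (p′ ∷ʳ x) → Full p → Full p′
  full-enter p p′ {y} {x} {y′} x≢y′ j full-x full =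
    full-third p′ x≢y′ full-x
      (spread {p ∷ʳ y} {p′ ∷ʳ y′} {y} {y′} (lab (p′ ∷ʳ y′) z ∷ []) (join-lab (join-∷ʳ j)) (full y) (s≤s z≤n) part)
    where
    z = third x y′
    part : ∀ t → Obs (lab (p′ ∷ʳ y′) t) ⊎ lab (p′ ∷ʳ y′) t ∈ (lab (p′ ∷ʳ y′) z ∷ [])
    part t with third-cover x y′ x≢y′ t
    ... | inj₁ refl        = inj₁ (subst Obs (join-lab (join-midpoint p′ x y′)) (full-x y′))
    ... | inj₂ (inj₁ refl) = inj₁ (subst Obs (join-lab (join-∷ʳ j)) (full y y))
    ... | inj₂ (inj₂ refl) = inj₂ (here refl)

  full-seed : Full a
  full-seed = full-third a {α} {β} (λ ())
    (obsCell-initial (a ∷ʳ α) β (here refl))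
    (obsCell-initial (a ∷ʳ β) α (here (sym (join-lab (join-midpoint a α β)))))

  full-closed : Closed α Full
  full-closed {p} {p′} j site≢ full with junctions-cover α p′
  ... | inj₁ refl = full-seed
  ... | inj₂ (q , y , q∈ , j′) = full-enter p p′ site≢ j
    (obsCell-initial (p′ ∷ʳ site α p′) (site α p′)
      (there (subst (_∈ map cornerLab (junctions m α)) (join-lab (join-∷ʳ j′)) (∈-map⁺ cornerLab q∈)))) full

  dominatingSet-dominates : IsKPowerDom (Sfrom (suc m)) 1 dominatingSet
  dominatingSet-dominates = obs-all λ w → go w (initLast w)
    where
    go : ∀ w → (∃ λ p → ∃ λ θ → w ≡ p ∷ʳ θ) → ObsCell w
    go w (p , θ , refl) = traverse-seed α Full (λ {p} {p′} → full-closed {p} {p′}) full-seed p θ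

  dominatingSet-length : length dominatingSet ≡ suc (length (junctions m α))
  dominatingSet-length = cong suc (length-map cornerLab (junctions m α))

-- The lower bound for k = 1

InCell : ∀ {m} → Cell m → ℕ → Set
InCell p v = ∃ λ θ → ∃ λ x → v ≡ lab (p ∷ʳ θ) x

-- The three midpoints of p form a fort: no corner of p is adjacent to exactly
-- one of them, so the first midpoint to be observed is adjacent or equal to a
-- vertex of D, and N[fort] ⊆ p.
fort : ∀ {m} (p : Cell m) (D : List ℕ) → All (_∈ V (Sfrom (suc m))) D → ∀ i {θ x} → θ ≢ x →
  T (P (Sfrom (suc m)) 1 D i (lab (p ∷ʳ θ) x)) → ∃ λ d → d ∈ D × InCell p d
fort {m} p D D⊆V = go
  where
  G : Graph
  G = Sfrom (suc m)

  -- A midpoint lies in two small triangles only, both inside `p`.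
  neighbour : ∀ {v θ x} → θ ≢ x → v ∈ V G → T (inN G v (lab (p ∷ʳ θ) x)) → InCell p v
  neighbour {θ = θ} {x} θ≢x v∈V t with w , y , z , refl , eq ← inN-address (suc m) v∈V t
    with twin-complete (p ∷ʳ θ) w x z eq
  ... | inj₁ refl = θ , y , refl
  ... | inj₂ eq′ with refl ← trans eq′ (twin-midpoint p θ≢x) = x , y , refl

  go : ∀ i {θ x} → θ ≢ x → T (P G 1 D i (lab (p ∷ʳ θ) x)) → ∃ λ d → d ∈ D × InCell p d
  go zero θ≢x t with d , d∈D , n ← any-∈⁻ _ D t = d , d∈D , neighbour θ≢x (All.lookup D⊆V d∈D) n
  go (suc i) θ≢x t with v , v∈V , pv , l , n ← P-suc⁻ G 1 D i t
    with φ , y , refl ← neighbour θ≢x v∈V n with φ ≟ᶜ y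
  -- Here `v` is itself a midpoint, observed at an earlier stage.
  ... | no φ≢y = go i φ≢y pv
  -- Here `v` is a corner of `p`, adjacent to two midpoints. With both unobserved it could not
  -- propagate, since k = 1.
  ... | yes refl with T? (P G 1 D i (lab (p ∷ʳ φ) (next φ)))
                    | T? (P G 1 D i (lab (p ∷ʳ φ) (third φ (next φ))))
  ...   | yes t₁ | _      = go i (next-≢ φ) t₁
  ...   | no _   | yes t₂ = go i (third-≢ˡ φ (next φ) (next-≢ φ) ∘ sym) t₂
  ...   | no ¬t₁ | no ¬t₂ = contradiction (≤-trans (unique-⊆⇒length≤ two unobserved) l) (<-irrefl refl)
    where
    u₁ = lab (p ∷ʳ φ) (next φ)
    u₂ = lab (p ∷ʳ φ) (third φ (next φ))
    two : Unique (u₁ ∷ u₂ ∷ [])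
    two = ((λ eq → third-≢ʳ φ (next φ) (next-≢ φ) (sym (lab-injʳ (p ∷ʳ φ) _ _ eq))) ∷ []) ∷ [] ∷ []
    unobserved : ∀ {u} → u ∈ (u₁ ∷ u₂ ∷ []) → u ∈ undominated G 1 D i (lab (p ∷ʳ φ) φ)
    unobserved (here refl) = ∈-undominated⁺ G 1 D i _ (lab∈V (p ∷ʳ φ) _) (inN-cell (p ∷ʳ φ) φ _) ¬t₁
    unobserved (there (here refl)) = ∈-undominated⁺ G 1 D i _ (lab∈V (p ∷ʳ φ) _) (inN-cell (p ∷ʳ φ) φ _) ¬t₂

-- A vertex has at most two addresses, hence contributes two copies, possibly equal.
cells-meeting : ∀ {m} D → All (_∈ V (Sfrom (suc m))) D →
  Σ (List (Cell m)) λ ps → length ps ≡ 2 * length D × (∀ {d p} → d ∈ D → InCell p d → p ∈ ps)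
cells-meeting [] [] = [] , refl , λ ()
cells-meeting {m} (d ∷ D) (d∈V ∷ D⊆V)
  with w , x , refl ← V-address (suc m) d∈V | ps , len , meets ← cells-meeting D D⊆V =
  init w ∷ init (proj₁ (twin w x)) ∷ ps
  , trans (cong (2 +_) len) (sym (*-suc 2 (length D)))
  , λ { (here refl) c → first c ; (there d∈) c → there (there (meets d∈ c)) }
  where
  first : ∀ {p} → InCell p (lab w x) → p ∈ (init w ∷ init (proj₁ (twin w x)) ∷ ps)
  first {p} (θ , y , eq) with twin-complete w (p ∷ʳ θ) x y eq
  ... | inj₁ refl = here (sym (init-∷ʳ θ p))
  ... | inj₂ eq′  = there (here (trans (sym (init-∷ʳ θ p)) (cong (init ∘ proj₁) eq′)))

length-cartesianProductWith : ∀ {X Y Z : Set} (f : X → Y → Z) xs ys →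
  length (cartesianProductWith f xs ys) ≡ length xs * length ys
length-cartesianProductWith f []       ys = refl
length-cartesianProductWith f (x ∷ xs) ys = trans (length-++ (map (f x) ys))
  (cong₂ _+_ (length-map (f x) ys) (length-cartesianProductWith f xs ys))

allCells : ∀ m → List (Cell m)
allCells zero    = [] ∷ []
allCells (suc m) = cartesianProductWith _∷_ (α ∷ β ∷ γ ∷ []) (allCells m)

allCells-unique : ∀ m → Unique (allCells m)
allCells-unique zero    = [] ∷ []
allCells-unique (suc m) = Unique.cartesianProductWith⁺ _∷_ ∷-injective
  (((λ ()) ∷ (λ ()) ∷ []) ∷ ((λ ()) ∷ []) ∷ [] ∷ []) (allCells-unique m)

allCells-length : ∀ m → length (allCells m) ≡ 3 ^ m
allCells-length zero    = refl
allCells-length (suc m) = trans (length-cartesianProductWith _∷_ (α ∷ β ∷ γ ∷ []) (allCells m)) (cong (3 *_) (allCells-length m))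

lower-bound : ∀ m D → IsKPowerDom (Sfrom (suc m)) 1 D → 3 ^ m ≤ 2 * length D
lower-bound m D (D⊆V , dom) with ps , len , meets ← cells-meeting D D⊆V =
  subst₂ _≤_ (allCells-length m) len (unique-⊆⇒length≤ (allCells-unique m) (λ {p} _ → met p))
  where
  met : ∀ p → p ∈ ps
  met p with i , eq ← dom _ (lab∈V (p ∷ʳ α) β)
    with d , d∈D , c ← fort p D D⊆V i (λ ()) (Equivalence.from T-≡ eq) = meets d∈D c

powerDom-k=1 : ∀ m → PowerDomNumber (Sfrom (suc m)) 1 ((3 ^ m + 1) / 2)
powerDom-k=1 m = subst (PowerDomNumber (Sfrom (suc m)) 1) (sym half)
  ((dominatingSet m , dominatingSet-dominates m , dominatingSet-length m) , least)
  where
  l : ℕ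
  l = length (junctions m α)

  half : (3 ^ m + 1) / 2 ≡ suc l
  half = trans (cong (λ t → (t + 1) / 2) (sym (junctions-length m α)))
    (trans (cong (_/ 2) (arith l)) (m*n/n≡m (suc l) 2))
    where
    arith : ∀ l → suc (2 * l) + 1 ≡ suc l * 2
    arith = solve-∀

  least : ∀ D → IsKPowerDom (Sfrom (suc m)) 1 D → suc l ≤ length D
  -- Since 3^m = 2l + 1, the bound 3^m ≤ 2|D| reads 2l < 2|D|.
  least D dom = *-cancelˡ-< 2 l (length D) (≤-trans (≤-reflexive (junctions-length m α)) (lower-bound m D dom))

theorem3 : (∀ k g → 1 ≤ k → 1 ≤ g →
    (2 ≤ g → k ≡ 1 → PowerDomNumber (𝒮 g) k ((3 ^ (g ∸ 2) + 1) / 2))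
    × (g ≡ 1 → k ≡ 1 → PowerDomNumber (𝒮 g) k 1)
    × (2 ≤ k → PowerDomNumber (𝒮 g) k 1))
theorem3 k g _ _ =
    -- Matching on `2 ≤ g` makes `g` equal to m + 2, so the graph is `Sfrom (suc m)` and the
    -- exponent is m.
    (λ { (s≤s (s≤s {n = m} _)) refl → powerDom-k=1 m })
  , (λ { refl _ → powerDom-one 0 k (inj₁ refl) })
  , (λ 2≤k → powerDom-one (g ∸ 1) k (inj₂ 2≤k))
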